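{- Let the polynomials $P_k(x)\in\mathbb{Q}[x]$ be defined by $P_0(x):=0$, $P_1(x):=1$ and, for $k\ge2$, $$P_k(x):=-\frac{1}{(2k-1)(k-1)}\sum_{i=1}^{k-1}\left(6x\binom{2k}{2i}(2^{2i-1}-1)+\binom{2k}{2i+2}(2^{2i+1}-1)-2^{2i}\binom{2k}{2i+1}+\binom{2k}{2i}\right)P_{k-i}(x).$$ Then for $k\ge2$, $$P_k(x)=(1-12x)P_{k-1}(x)-36x^2P_{k-2}(x),$$ and for $k\ge1$, $$P_k(x)=2^{1-2k}\sum_{j=0}^{k-1}\binom{2k}{2j+1}(1-24x)^j=\frac{1}{\sqrt{1-24x}}\left(\Big(\frac{1+\sqrt{1-24x}}2\Big)^{2k}-\Big(\frac{1-\sqrt{1-24x}}2\Big)^{2k}\right).$$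
   Context: These polynomials are the ones for which the second rank moment generating function $\mathcal{R}_2$ enters the expression of the higher rank moment generating functions $\mathcal{R}_{2k}$ via $P_k(\delta_q)\mathcal{R}_2$ with $\delta_q=q\,\frac{d}{dq}$; the recursive definition above is the one the paper derives. -}

module Defs where

open import Data.Nat as ℕ using (ℕ; zero; suc)
open import Data.Nat.Combinatorics using (_C_)
open import Data.Integer using (+_)
open import Data.Rational using (ℚ; 0ℚ; 1ℚ; ½; _+_; _*_; _-_; -_; _/_)
open import Data.List using (List; []; _∷_; _++_; map; upTo; foldr)
open import Data.Product using (_×_; _,_)

ℕ→ℚ : ℕ → ℚ
ℕ→ℚ n = + n / 1

infixr 8 _^ℚ_
_^ℚ_ : ℚ → ℕ → ℚ
q ^ℚ zero = 1ℚ
q ^ℚ suc n = q * (q ^ℚ n)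

at : List ℚ → ℕ → ℚ
at [] _ = 0ℚ
at (q ∷ _) zero = q
at (_ ∷ qs) (suc n) = at qs n

sumℚ : List ℚ → ℚ
sumℚ = foldr _+_ 0ℚ

Σ[1≤i≤_]_ : ℕ → (ℕ → ℚ) → ℚ
Σ[1≤i≤ n ] f = sumℚ (map (λ i → f (suc i)) (upTo n))

Σ[0≤j<_]_ : ℕ → (ℕ → ℚ) → ℚ
Σ[0≤j< n ] f = sumℚ (map f (upTo n))

coef : ℕ → ℕ → ℚ → ℚ
coef k i x =
    ℕ→ℚ 6 * x * ℕ→ℚ ((2 ℕ.* k) C (2 ℕ.* i)) * (ℕ→ℚ 2 ^ℚ (2 ℕ.* i ℕ.∸ 1) - 1ℚ)
  + ℕ→ℚ ((2 ℕ.* k) C (2 ℕ.* i ℕ.+ 2)) * (ℕ→ℚ 2 ^ℚ (2 ℕ.* i ℕ.+ 1) - 1ℚ)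
  - ℕ→ℚ 2 ^ℚ (2 ℕ.* i) * ℕ→ℚ ((2 ℕ.* k) C (2 ℕ.* i ℕ.+ 1))
  + ℕ→ℚ ((2 ℕ.* k) C (2 ℕ.* i))

-- table x n = [P_0(x), P_1(x), ..., P_n(x)]
table : ℚ → ℕ → List ℚ
table x zero = 0ℚ ∷ []
table x (suc zero) = 0ℚ ∷ 1ℚ ∷ []
table x (suc (suc m)) =
  let t = table x (suc m)
      k = suc (suc m)
  -- 1/((2k-1)(k-1)) with (2k-1)(k-1) = (2m+3)(m+1)
  in t ++ ((- ((+ 1) / ((3 ℕ.+ 2 ℕ.* m) ℕ.* suc m)))
             * (Σ[1≤i≤ suc m ] (λ i → coef k i x * at t (k ℕ.∸ i)))) ∷ []

P : ℕ → ℚ → ℚ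
P k x = at (table x k) k

-- The quadratic extension ℚ(√d) for a formal square root s of d:
-- the pair (u , v) represents u + v·s, where s·s = d.
QExt : Set
QExt = ℚ × ℚ

_⊖[_]_ : QExt → ℚ → QExt → QExt
(u₁ , v₁) ⊖[ d ] (u₂ , v₂) = (u₁ - u₂ , v₁ - v₂)

mulQ : ℚ → QExt → QExt → QExt
mulQ d (u₁ , v₁) (u₂ , v₂) = (u₁ * u₂ + d * (v₁ * v₂) , u₁ * v₂ + v₁ * u₂)

powQ : ℚ → QExt → ℕ → QExt
powQ d a zero = (1ℚ , 0ℚ)
powQ d a (suc n) = mulQ d a (powQ d a n)

{-# OPTIONS --safe #-}
-- Put d = 1 − 24x and α, β = (1 ± √d)/2 in ℚ(√d), so that α + β = 1 and αβ = 6x. Then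
-- α² and β² are the roots of t² − (1 − 12x)t + 36x², so the sequence U with U₀ = 0, U₁ = 1
-- and the claimed two-term recurrence satisfies √d·U_k = α^{2k} − β^{2k}.
-- Splitting binomial expansions into even and odd parts shows that, whenever a + b = 1 and
-- ab = 6x, twice Σ_{i=0}^{k} coef_{k,i}(x)·a^{2k−2i} equals a(1+b)^{2k} + b(1+a)^{2k} + a^{2k+1} + b^{2k+1},
-- which is symmetric in a and b. Hence Σ_{i=0}^{k} coef_{k,i}(x)·U_{k−i} = 0; as coef_{k,0}(x) = (2k−1)(k−1),
-- this is exactly the recursion defining P_k, so P_k = U_k. The closed form is the odd part of
-- (1 + √d)^{2k} − (1 − √d)^{2k} = 2^{2k}·√d·U_k.
module Submission where

open import Defs
open import Algebra.Bundles using (CommutativeRing)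
open import Algebra.Structures using (IsCommutativeRing)
open import Level using (0ℓ)
import Algebra.Solver.Ring
open import Algebra.Solver.Ring.AlmostCommutativeRing using (_-Raw-AlmostCommutative⟶_; fromCommutativeRing)
import Data.Maybe as Maybe
open import Relation.Binary.Consequences using (dec⇒weaklyDec)
open import Data.Nat as ℕ using (ℕ; zero; suc; _≤_; _<_; _∸_; z≤n; s≤s)
import Data.Nat.Properties as ℕₚ
open import Data.Nat.Solver using () renaming (module +-*-Solver to ℕ-Solver)
open import Data.Nat.Combinatorics using (_C_; nCk+nC[k+1]≡[n+1]C[k+1]; k>n⇒nCk≡0; nC1≡n)
open import Data.List using (List; []; _∷_; _++_; map; applyUpTo; length)
open import Data.List.Properties using (length-++)
open import Data.Product using (_×_; _,_; proj₂)
open import Data.Sum using (inj₁; inj₂)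
open import Function using (_∘_)
open import Relation.Binary.PropositionalEquality using (_≡_; refl; sym; trans; cong; cong₂; subst; isEquivalence; module ≡-Reasoning)

2*suc : ∀ i → 2 ℕ.* suc i ≡ suc (suc (2 ℕ.* i))
2*suc i = cong suc (ℕₚ.+-suc i (i ℕ.+ 0))

∸-suc : ∀ {j n} → j < n → n ∸ j ≡ suc (n ∸ suc j)
∸-suc {zero}  (s≤s _)   = refl
∸-suc {suc j} (s≤s j<n) = ∸-suc j<n

2k∸2i≡2+[2k∸2[1+i]] : ∀ {i k} → i < k → 2 ℕ.* k ∸ 2 ℕ.* i ≡ suc (suc (2 ℕ.* k ∸ 2 ℕ.* suc i))
2k∸2i≡2+[2k∸2[1+i]] {i} {k} i<k = begin
  2 ℕ.* k ∸ 2 ℕ.* i                ≡⟨ ℕₚ.*-distribˡ-∸ 2 k i ⟨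
  2 ℕ.* (k ∸ i)                    ≡⟨ cong (2 ℕ.*_) (∸-suc i<k) ⟩
  2 ℕ.* suc (k ∸ suc i)            ≡⟨ 2*suc (k ∸ suc i) ⟩
  suc (suc (2 ℕ.* (k ∸ suc i)))    ≡⟨ cong (suc ∘ suc) (ℕₚ.*-distribˡ-∸ 2 k (suc i)) ⟩
  suc (suc (2 ℕ.* k ∸ 2 ℕ.* suc i)) ∎
  where open ≡-Reasoning

2*[nC2]+n≡n*n : ∀ n → 2 ℕ.* (n C 2) ℕ.+ n ≡ n ℕ.* n
2*[nC2]+n≡n*n zero    = refl
2*[nC2]+n≡n*n (suc n) = begin
  2 ℕ.* (suc n C 2) ℕ.+ suc n                ≡⟨ cong (λ m → 2 ℕ.* m ℕ.+ suc n) (nCk+nC[k+1]≡[n+1]C[k+1] n 1) ⟨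
  2 ℕ.* (n C 1 ℕ.+ n C 2) ℕ.+ suc n          ≡⟨ cong (λ m → 2 ℕ.* (m ℕ.+ n C 2) ℕ.+ suc n) (nC1≡n n) ⟩
  2 ℕ.* (n ℕ.+ n C 2) ℕ.+ suc n              ≡⟨ solve 2 (λ n c → con 2 :* (n :+ c) :+ (con 1 :+ n) := (con 2 :* c :+ n) :+ (con 2 :* n :+ con 1)) refl n (n C 2) ⟩
  (2 ℕ.* (n C 2) ℕ.+ n) ℕ.+ (2 ℕ.* n ℕ.+ 1)  ≡⟨ cong (ℕ._+ (2 ℕ.* n ℕ.+ 1)) (2*[nC2]+n≡n*n n) ⟩
  n ℕ.* n ℕ.+ (2 ℕ.* n ℕ.+ 1)                ≡⟨ solve 1 (λ n → n :* n :+ (con 2 :* n :+ con 1) := (con 1 :+ n) :* (con 1 :+ n)) refl n ⟩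
  suc n ℕ.* suc n                            ∎
  where
  open ≡-Reasoning
  open ℕ-Solver

[2k]C2+1 : ∀ m → (2 ℕ.* suc (suc m)) C 2 ℕ.+ 1 ≡ (3 ℕ.+ 2 ℕ.* m) ℕ.* suc m ℕ.+ 2 ℕ.* suc (suc m)
[2k]C2+1 m = ℕₚ.*-cancelˡ-≡ _ _ 2 (ℕₚ.+-cancelʳ-≡ (2 ℕ.* n) _ _ (begin
  2 ℕ.* (n C 2 ℕ.+ 1) ℕ.+ 2 ℕ.* n        ≡⟨ solve 2 (λ c n → con 2 :* (c :+ con 1) :+ con 2 :* n := (con 2 :* c :+ n) :+ (n :+ con 2)) refl (n C 2) n ⟩
  (2 ℕ.* (n C 2) ℕ.+ n) ℕ.+ (n ℕ.+ 2)    ≡⟨ cong (ℕ._+ (n ℕ.+ 2)) (2*[nC2]+n≡n*n n) ⟩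
  n ℕ.* n ℕ.+ (n ℕ.+ 2)                  ≡⟨ solve 1 (λ m → (con 2 :* (con 2 :+ m)) :* (con 2 :* (con 2 :+ m)) :+ (con 2 :* (con 2 :+ m) :+ con 2)
                                                  := con 2 :* ((con 3 :+ con 2 :* m) :* (con 1 :+ m) :+ con 2 :* (con 2 :+ m)) :+ con 2 :* (con 2 :* (con 2 :+ m))) refl m ⟩
  2 ℕ.* ((3 ℕ.+ 2 ℕ.* m) ℕ.* suc m ℕ.+ n) ℕ.+ 2 ℕ.* n ∎))
  where
  open ≡-Reasoning
  open ℕ-Solver
  n = 2 ℕ.* suc (suc m)

cong₃ : ∀ {A B C D : Set} (f : A → B → C → D) {a a′ b b′ c c′} → a ≡ a′ → b ≡ b′ → c ≡ c′ → f a b c ≡ f a′ b′ c′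
cong₃ f refl refl refl = refl

-- Declared before the ℚ imports, whose operator names would clash with the ring's.
module CommutativeRingSum {c ℓ} (R : CommutativeRing c ℓ) where

  open CommutativeRing R renaming (refl to ≈-refl; sym to ≈-sym; trans to ≈-trans)
  open import Algebra.Properties.CommutativeSemigroup +-commutativeSemigroup using (interchange)
  open import Algebra.Properties.Ring ring using (-‿+-comm; -0#≈0#)
  open import Relation.Binary.Reasoning.Setoid setoid

  ∑ : ℕ → (ℕ → Carrier) → Carrier
  ∑ zero    f = 0#
  ∑ (suc n) f = f 0 + ∑ n (f ∘ suc)

  ∑-cong : ∀ n {f g : ℕ → Carrier} → (∀ i → i < n → f i ≈ g i) → ∑ n f ≈ ∑ n g
  ∑-cong zero    f≈g = ≈-refl
  ∑-cong (suc n) f≈g = +-cong (f≈g 0 (s≤s z≤n)) (∑-cong n (λ i i<n → f≈g (suc i) (s≤s i<n)))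

  ∑-last : ∀ n (f : ℕ → Carrier) → ∑ (suc n) f ≈ ∑ n f + f n
  ∑-last zero    f = ≈-trans (+-identityʳ (f 0)) (≈-sym (+-identityˡ (f 0)))
  ∑-last (suc n) f = begin
    f 0 + ∑ (suc n) (f ∘ suc)          ≈⟨ +-congˡ (∑-last n (f ∘ suc)) ⟩
    f 0 + (∑ n (f ∘ suc) + f (suc n))  ≈⟨ +-assoc (f 0) _ _ ⟨
    ∑ (suc n) f + f (suc n)            ∎

  ∑-+ : ∀ n (f g : ℕ → Carrier) → ∑ n (λ i → f i + g i) ≈ ∑ n f + ∑ n g
  ∑-+ zero    f g = ≈-sym (+-identityʳ 0#)
  ∑-+ (suc n) f g = ≈-trans (+-congˡ (∑-+ n (f ∘ suc) (g ∘ suc))) (interchange (f 0) (g 0) _ _)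

  ∑-- : ∀ n (f g : ℕ → Carrier) → ∑ n (λ i → f i - g i) ≈ ∑ n f - ∑ n g
  ∑-- n f g = ≈-trans (∑-+ n f (λ i → - g i)) (+-congˡ (∑-neg n g))
    where
    ∑-neg : ∀ n (g : ℕ → Carrier) → ∑ n (λ i → - g i) ≈ - ∑ n g
    ∑-neg zero    g = ≈-sym -0#≈0#
    ∑-neg (suc n) g = ≈-trans (+-congˡ (∑-neg n (g ∘ suc))) (-‿+-comm (g 0) _)

  ∑-last-zero : ∀ n (f : ℕ → Carrier) → f n ≈ 0# → ∑ (suc n) f ≈ ∑ n f
  ∑-last-zero n f fn≈0 = ≈-trans (∑-last n f) (≈-trans (+-congˡ fn≈0) (+-identityʳ (∑ n f)))

  *-distribˡ-∑ : ∀ n a (f : ℕ → Carrier) → a * ∑ n f ≈ ∑ n (λ i → a * f i)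
  *-distribˡ-∑ zero    a f = zeroʳ a
  *-distribˡ-∑ (suc n) a f = ≈-trans (distribˡ a (f 0) _) (+-congˡ (*-distribˡ-∑ n a (f ∘ suc)))

  ∑-even-odd : ∀ k (f : ℕ → Carrier) →
               ∑ (suc (2 ℕ.* k)) f ≈ ∑ (suc k) (λ i → f (2 ℕ.* i)) + ∑ k (λ i → f (suc (2 ℕ.* i)))
  ∑-even-odd zero    f = ≈-sym (+-identityʳ _)
  ∑-even-odd (suc k) f = begin
    ∑ (suc (2 ℕ.* suc k)) f                          ≡⟨ cong (λ m → ∑ (suc m) f) (2*suc k) ⟩
    f 0 + (f 1 + ∑ (suc (2 ℕ.* k)) (f ∘ suc ∘ suc))  ≈⟨ +-congˡ (+-congˡ (∑-even-odd k (f ∘ suc ∘ suc))) ⟩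
    f 0 + (f 1 + (E + O))                            ≈⟨ +-congˡ (x∙yz≈y∙xz (f 1) E O) ⟩
    f 0 + (E + (f 1 + O))                            ≈⟨ +-assoc (f 0) E _ ⟨
    (f 0 + E) + (f 1 + O)                            ≈⟨ +-cong (+-congˡ (∑-cong (suc k) (λ i _ → reflexive (cong f (sym (2*suc i))))))
                                                               (+-congˡ (∑-cong k (λ i _ → reflexive (cong (f ∘ suc) (sym (2*suc i)))))) ⟩
    ∑ (suc (suc k)) (λ i → f (2 ℕ.* i)) + ∑ (suc k) (λ i → f (suc (2 ℕ.* i))) ∎
    where
    open import Algebra.Properties.CommutativeSemigroup +-commutativeSemigroup using (x∙yz≈y∙xz)
    E = ∑ (suc k) (λ i → f (suc (suc (2 ℕ.* i))))
    O = ∑ k (λ i → f (suc (suc (suc (2 ℕ.* i)))))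

open import Data.Integer as ℤ using (+_)
import Data.Integer.Properties as ℤₚ
open import Data.Rational using (ℚ; 0ℚ; 1ℚ; ½; _+_; _*_; _-_; -_; _/_; toℚᵘ)
import Data.Rational.Properties as ℚₚ
open import Data.Rational.Solver using () renaming (module +-*-Solver to ℚ-Solver)
import Data.Rational.Unnormalised as ℚᵘ
import Data.Rational.Unnormalised.Properties as ℚᵘₚ

ℕ→ℚ-toℚᵘ : ∀ n → toℚᵘ (ℕ→ℚ n) ℚᵘ.≃ ℚᵘ.mkℚᵘ (+ n) 0
ℕ→ℚ-toℚᵘ n = ℚₚ.toℚᵘ-fromℚᵘ (ℚᵘ.mkℚᵘ (+ n) 0)

ℕ→ℚ-+ : ∀ m n → ℕ→ℚ (m ℕ.+ n) ≡ ℕ→ℚ m + ℕ→ℚ n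
ℕ→ℚ-+ m n = ℚₚ.toℚᵘ-injective (begin
  toℚᵘ (ℕ→ℚ (m ℕ.+ n))                  ≈⟨ ℕ→ℚ-toℚᵘ (m ℕ.+ n) ⟩
  ℚᵘ.mkℚᵘ (+ (m ℕ.+ n)) 0                ≈⟨ ℚᵘ.*≡* (cong (ℤ._* + 1) +-numerators) ⟩
  ℚᵘ.mkℚᵘ (+ m) 0 ℚᵘ.+ ℚᵘ.mkℚᵘ (+ n) 0   ≈⟨ ℚᵘₚ.+-cong (ℕ→ℚ-toℚᵘ m) (ℕ→ℚ-toℚᵘ n) ⟨
  toℚᵘ (ℕ→ℚ m) ℚᵘ.+ toℚᵘ (ℕ→ℚ n)        ≈⟨ ℚₚ.toℚᵘ-homo-+ (ℕ→ℚ m) (ℕ→ℚ n) ⟨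
  toℚᵘ (ℕ→ℚ m + ℕ→ℚ n)                  ∎)
  where
  open ℚᵘₚ.≃-Reasoning
  +-numerators : + (m ℕ.+ n) ≡ + m ℤ.* + 1 ℤ.+ + n ℤ.* + 1
  +-numerators = trans (ℤₚ.pos-+ m n) (sym (cong₂ ℤ._+_ (ℤₚ.*-identityʳ (+ m)) (ℤₚ.*-identityʳ (+ n))))

1/[1+n]*[1+n]≡1 : ∀ n → (+ 1 / suc n) * ℕ→ℚ (suc n) ≡ 1ℚ
1/[1+n]*[1+n]≡1 n = ℚₚ.toℚᵘ-injective (begin
  toℚᵘ ((+ 1 / suc n) * ℕ→ℚ (suc n))                  ≈⟨ ℚₚ.toℚᵘ-homo-* (+ 1 / suc n) (ℕ→ℚ (suc n)) ⟩
  toℚᵘ (+ 1 / suc n) ℚᵘ.* toℚᵘ (ℕ→ℚ (suc n))          ≈⟨ ℚᵘₚ.*-cong (ℚₚ.toℚᵘ-fromℚᵘ (ℚᵘ.mkℚᵘ (+ 1) n)) (ℕ→ℚ-toℚᵘ (suc n)) ⟩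
  ℚᵘ.mkℚᵘ (+ 1) n ℚᵘ.* ℚᵘ.mkℚᵘ (+ suc n) 0            ≈⟨ ℚᵘ.*≡* (cong (+_ ∘ suc) (trans (ℕₚ.*-identityʳ (n ℕ.+ 0)) (cong (ℕ._+ 0) (sym (ℕₚ.*-identityʳ n))))) ⟩
  toℚᵘ 1ℚ                                              ∎)
  where open ℚᵘₚ.≃-Reasoning

½^n*2^n≡1 : ∀ n → ½ ^ℚ n * ℕ→ℚ 2 ^ℚ n ≡ 1ℚ
½^n*2^n≡1 zero = refl
½^n*2^n≡1 (suc n) = begin
  ½ * ½ ^ℚ n * (ℕ→ℚ 2 * ℕ→ℚ 2 ^ℚ n)   ≡⟨ solve 2 (λ h t → con ½ :* h :* (con (ℕ→ℚ 2) :* t) := con ½ :* con (ℕ→ℚ 2) :* (h :* t)) refl (½ ^ℚ n) (ℕ→ℚ 2 ^ℚ n) ⟩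
  ½ * ℕ→ℚ 2 * (½ ^ℚ n * ℕ→ℚ 2 ^ℚ n)   ≡⟨ cong (½ * ℕ→ℚ 2 *_) (½^n*2^n≡1 n) ⟩
  1ℚ                                  ∎
  where
  open ≡-Reasoning
  open ℚ-Solver

open CommutativeRingSum ℚₚ.+-*-commutativeRing using () renaming (∑ to ∑ℚ; ∑-cong to ∑ℚ-cong; ∑-last to ∑ℚ-last)

sumℚ-map-applyUpTo : ∀ n (g : ℕ → ℚ) (f : ℕ → ℕ) → sumℚ (map g (applyUpTo f n)) ≡ ∑ℚ n (g ∘ f)
sumℚ-map-applyUpTo zero    g f = refl
sumℚ-map-applyUpTo (suc n) g f = cong (_+_ (g (f 0))) (sumℚ-map-applyUpTo n g (f ∘ suc))

module QuadraticExtension (d : ℚ) where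

  infixl 6 _⊕_ _⊟_
  infixl 7 _⊗_
  infix  8 ⊝_

  _⊕_ : QExt → QExt → QExt
  (a , b) ⊕ (a′ , b′) = (a + a′ , b + b′)

  ⊝_ : QExt → QExt
  ⊝ (a , b) = (- a , - b)

  _⊗_ : QExt → QExt → QExt
  _⊗_ = mulQ d

  _⊟_ : QExt → QExt → QExt
  x ⊟ y = x ⊖[ d ] y

  ι : ℚ → QExt
  ι q = (q , 0ℚ)

  0ᵉ 1ᵉ √d : QExt
  0ᵉ = ι 0ℚ
  1ᵉ = ι 1ℚ
  √d = (0ℚ , 1ℚ)

  isCommutativeRing : IsCommutativeRing _≡_ _⊕_ _⊗_ ⊝_ 0ᵉ 1ᵉ
  isCommutativeRing = record
    { isRing = record
      { +-isAbelianGroup = record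
        { isGroup = record
          { isMonoid = record
            { isSemigroup = record
              { isMagma = record { isEquivalence = isEquivalence ; ∙-cong = cong₂ _⊕_ }
              ; assoc = λ (a , b) (a′ , b′) (a″ , b″) → cong₂ _,_ (ℚₚ.+-assoc a a′ a″) (ℚₚ.+-assoc b b′ b″) }
            ; identity = (λ (a , b) → cong₂ _,_ (ℚₚ.+-identityˡ a) (ℚₚ.+-identityˡ b))
                       , (λ (a , b) → cong₂ _,_ (ℚₚ.+-identityʳ a) (ℚₚ.+-identityʳ b)) }
          ; inverse = (λ (a , b) → cong₂ _,_ (ℚₚ.+-inverseˡ a) (ℚₚ.+-inverseˡ b))
                    , (λ (a , b) → cong₂ _,_ (ℚₚ.+-inverseʳ a) (ℚₚ.+-inverseʳ b))
          ; ⁻¹-cong = cong ⊝_ }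
        ; comm = λ (a , b) (a′ , b′) → cong₂ _,_ (ℚₚ.+-comm a a′) (ℚₚ.+-comm b b′) }
      ; *-cong = cong₂ _⊗_
      ; *-assoc = λ (a , b) (a′ , b′) (a″ , b″) → cong₂ _,_
          (solve 7 (λ d a b a′ b′ a″ b″ → (a :* a′ :+ d :* (b :* b′)) :* a″ :+ d :* ((a :* b′ :+ b :* a′) :* b″)
                                          := a :* (a′ :* a″ :+ d :* (b′ :* b″)) :+ d :* (b :* (a′ :* b″ :+ b′ :* a″))) refl d a b a′ b′ a″ b″)
          (solve 7 (λ d a b a′ b′ a″ b″ → (a :* a′ :+ d :* (b :* b′)) :* b″ :+ (a :* b′ :+ b :* a′) :* a″
                                          := a :* (a′ :* b″ :+ b′ :* a″) :+ b :* (a′ :* a″ :+ d :* (b′ :* b″))) refl d a b a′ b′ a″ b″)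
      ; *-identity = (λ (a , b) → cong₂ _,_ (solve 3 (λ d a b → con 1ℚ :* a :+ d :* (con 0ℚ :* b) := a) refl d a b)
                                            (solve 2 (λ a b → con 1ℚ :* b :+ con 0ℚ :* a := b) refl a b))
                   , (λ (a , b) → cong₂ _,_ (solve 3 (λ d a b → a :* con 1ℚ :+ d :* (b :* con 0ℚ) := a) refl d a b)
                                            (solve 2 (λ a b → a :* con 0ℚ :+ b :* con 1ℚ := b) refl a b))
      ; distrib = (λ (a , b) (a′ , b′) (a″ , b″) → cong₂ _,_
                     (solve 7 (λ d a b a′ b′ a″ b″ → a :* (a′ :+ a″) :+ d :* (b :* (b′ :+ b″))
                                                     := (a :* a′ :+ d :* (b :* b′)) :+ (a :* a″ :+ d :* (b :* b″))) refl d a b a′ b′ a″ b″)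
                     (solve 6 (λ a b a′ b′ a″ b″ → a :* (b′ :+ b″) :+ b :* (a′ :+ a″)
                                                   := (a :* b′ :+ b :* a′) :+ (a :* b″ :+ b :* a″)) refl a b a′ b′ a″ b″))
                , (λ (a , b) (a′ , b′) (a″ , b″) → cong₂ _,_
                     (solve 7 (λ d a b a′ b′ a″ b″ → (a′ :+ a″) :* a :+ d :* ((b′ :+ b″) :* b)
                                                     := (a′ :* a :+ d :* (b′ :* b)) :+ (a″ :* a :+ d :* (b″ :* b))) refl d a b a′ b′ a″ b″)
                     (solve 6 (λ a b a′ b′ a″ b″ → (a′ :+ a″) :* b :+ (b′ :+ b″) :* a
                                                   := (a′ :* b :+ b′ :* a) :+ (a″ :* b :+ b″ :* a)) refl a b a′ b′ a″ b″))
      }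
    ; *-comm = λ (a , b) (a′ , b′) → cong₂ _,_
        (solve 5 (λ d a b a′ b′ → a :* a′ :+ d :* (b :* b′) := a′ :* a :+ d :* (b′ :* b)) refl d a b a′ b′)
        (solve 4 (λ a b a′ b′ → a :* b′ :+ b :* a′ := a′ :* b :+ b′ :* a) refl a b a′ b′)
    }
    where open ℚ-Solver

  commutativeRing : CommutativeRing 0ℓ 0ℓ
  commutativeRing = record { isCommutativeRing = isCommutativeRing }

  ι-* : ∀ p q → ι (p * q) ≡ ι p ⊗ ι q
  ι-* p q = cong₂ _,_ (solve 3 (λ d p q → p :* q := p :* q :+ d :* (con 0ℚ :* con 0ℚ)) refl d p q)
                      (solve 2 (λ p q → con 0ℚ := p :* con 0ℚ :+ con 0ℚ :* q) refl p q)
    where open ℚ-Solver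

  ι-morphism : CommutativeRing.rawRing ℚₚ.+-*-commutativeRing -Raw-AlmostCommutative⟶ fromCommutativeRing commutativeRing
  ι-morphism = record
    { ⟦_⟧ = ι ; +-homo = λ _ _ → refl ; *-homo = ι-* ; -‿homo = λ _ → refl ; 0-homo = refl ; 1-homo = refl }

  -- Ring solver for ℚ(√d) with rational coefficients: `con q` denotes ι q.
  module Solver = Algebra.Solver.Ring (CommutativeRing.rawRing ℚₚ.+-*-commutativeRing) (fromCommutativeRing commutativeRing)
                    ι-morphism (λ p q → Maybe.map (cong ι) (dec⇒weaklyDec ℚₚ._≟_ p q))

  open CommutativeRing commutativeRing public using (*-comm; -‿inverseʳ)
  open import Algebra.Properties.Ring (CommutativeRing.ring commutativeRing) public using (x[y-z]≈xy-xz)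
  open CommutativeRingSum commutativeRing public

  open import Algebra.Properties.CommutativeSemiring.Exp (CommutativeRing.commutativeSemiring commutativeRing) public
    using (_^_; ^-homo-*; ^-assocʳ; ^-distrib-*)

  powQ≡^ : ∀ x n → powQ d x n ≡ x ^ n
  powQ≡^ x zero    = refl
  powQ≡^ x (suc n) = cong (x ⊗_) (powQ≡^ x n)

  ι-^ : ∀ q n → ι (q ^ℚ n) ≡ ι q ^ n
  ι-^ q zero    = refl
  ι-^ q (suc n) = trans (ι-* q (q ^ℚ n)) (cong (ι q ⊗_) (ι-^ q n))

  1^n≡1 : ∀ n → 1ᵉ ^ n ≡ 1ᵉ
  1^n≡1 zero    = refl
  1^n≡1 (suc n) = trans (cong (1ᵉ ⊗_) (1^n≡1 n)) (solve 0 (con 1ℚ :* con 1ℚ := con 1ℚ) refl)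
    where open Solver

  ^-double : ∀ x n → x ^ (2 ℕ.* n) ≡ (x ⊗ x) ^ n
  ^-double x n = trans (sym (^-assocʳ x 2 n)) (cong (_^ n) (solve 1 (λ x → x :* (x :* con 1ℚ) := x :* x) refl x))
    where open Solver

  ⊝x^2n≡x^2n : ∀ x n → (⊝ x) ^ (2 ℕ.* n) ≡ x ^ (2 ℕ.* n)
  ⊝x^2n≡x^2n x n = begin
    (⊝ x) ^ (2 ℕ.* n)     ≡⟨ ^-double (⊝ x) n ⟩
    (⊝ x ⊗ ⊝ x) ^ n       ≡⟨ cong (_^ n) (solve 1 (λ x → :- x :* :- x := x :* x) refl x) ⟩
    (x ⊗ x) ^ n           ≡⟨ ^-double x n ⟨
    x ^ (2 ℕ.* n)         ∎
    where
    open ≡-Reasoning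
    open Solver

  fromℕ : ℕ → QExt
  fromℕ n = ι (ℕ→ℚ n)

  binomialTerm : ℕ → QExt → QExt → ℕ → QExt
  binomialTerm n a c j = fromℕ (n C j) ⊗ c ^ j ⊗ a ^ (n ∸ j)

  binomial-theorem : ∀ n a c → (a ⊕ c) ^ n ≡ ∑ (suc n) (binomialTerm n a c)
  binomial-theorem zero    a c = solve 0 (con 1ℚ := con 1ℚ :* con 1ℚ :* con 1ℚ :+ con 0ℚ) refl
    where open Solver
  binomial-theorem (suc n) a c = begin
    (a ⊕ c) ⊗ (a ⊕ c) ^ n                                ≡⟨ cong ((a ⊕ c) ⊗_) (binomial-theorem n a c) ⟩
    (a ⊕ c) ⊗ (T 0 ⊕ S)                                  ≡⟨ solve 4 (λ a c A S → (a :+ c) :* (con 1ℚ :* con 1ℚ :* A :+ S)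
                                                              := con 1ℚ :* con 1ℚ :* (a :* A) :+ (c :* (con 1ℚ :* con 1ℚ :* A :+ S) :+ a :* S))
                                                              refl a c (a ^ n) S ⟩
    T′ 0 ⊕ (c ⊗ ∑ (suc n) T ⊕ a ⊗ S)                     ≡⟨ cong₂ (λ s u → T′ 0 ⊕ (s ⊕ u)) (*-distribˡ-∑ (suc n) c T) a⊗S≡∑U ⟩
    T′ 0 ⊕ (∑ (suc n) (λ j → c ⊗ T j) ⊕ ∑ n U)          ≡⟨ cong (λ u → T′ 0 ⊕ (∑ (suc n) (λ j → c ⊗ T j) ⊕ u)) (∑-last-zero n U U-last) ⟨
    T′ 0 ⊕ (∑ (suc n) (λ j → c ⊗ T j) ⊕ ∑ (suc n) U)    ≡⟨ cong (T′ 0 ⊕_) (∑-+ (suc n) (λ j → c ⊗ T j) U) ⟨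
    T′ 0 ⊕ ∑ (suc n) (λ j → c ⊗ T j ⊕ U j)              ≡⟨ cong (T′ 0 ⊕_) (∑-cong (suc n) (λ j _ → pascal j)) ⟨
    ∑ (suc (suc n)) T′                                   ∎
    where
    open ≡-Reasoning
    open Solver
    T = binomialTerm n a c
    T′ = binomialTerm (suc n) a c
    S = ∑ n (T ∘ suc)
    U : ℕ → QExt
    U j = fromℕ (n C suc j) ⊗ c ^ suc j ⊗ a ^ (n ∸ j)

    pascal : ∀ j → T′ (suc j) ≡ c ⊗ T j ⊕ U j
    pascal j = begin
      fromℕ (suc n C suc j) ⊗ c ^ suc j ⊗ a ^ (n ∸ j)                   ≡⟨ cong (λ m → fromℕ m ⊗ c ^ suc j ⊗ a ^ (n ∸ j)) (nCk+nC[k+1]≡[n+1]C[k+1] n j) ⟨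
      fromℕ (n C j ℕ.+ n C suc j) ⊗ c ^ suc j ⊗ a ^ (n ∸ j)             ≡⟨ cong (λ x → ι x ⊗ c ^ suc j ⊗ a ^ (n ∸ j)) (ℕ→ℚ-+ (n C j) (n C suc j)) ⟩
      (fromℕ (n C j) ⊕ fromℕ (n C suc j)) ⊗ (c ⊗ c ^ j) ⊗ a ^ (n ∸ j)   ≡⟨ solve 5 (λ X Y c C A → (X :+ Y) :* (c :* C) :* A := c :* (X :* C :* A) :+ Y :* (c :* C) :* A) refl
                                                                            (fromℕ (n C j)) (fromℕ (n C suc j)) c (c ^ j) (a ^ (n ∸ j)) ⟩
      c ⊗ T j ⊕ U j                                                       ∎

    U-last : U n ≡ 0ᵉ
    U-last = begin
      fromℕ (n C suc n) ⊗ c ^ suc n ⊗ a ^ (n ∸ n)  ≡⟨ cong (λ m → fromℕ m ⊗ c ^ suc n ⊗ a ^ (n ∸ n)) (k>n⇒nCk≡0 (ℕₚ.n<1+n n)) ⟩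
      fromℕ 0 ⊗ c ^ suc n ⊗ a ^ (n ∸ n)            ≡⟨ solve 2 (λ C A → con 0ℚ :* C :* A := con 0ℚ) refl (c ^ suc n) (a ^ (n ∸ n)) ⟩
      0ᵉ                                            ∎

    a⊗S≡∑U : a ⊗ S ≡ ∑ n U
    a⊗S≡∑U = trans (*-distribˡ-∑ n a (T ∘ suc)) (∑-cong n (λ j j<n → begin
      a ⊗ (fromℕ (n C suc j) ⊗ c ^ suc j ⊗ a ^ (n ∸ suc j))  ≡⟨ solve 4 (λ a X C A → a :* (X :* C :* A) := X :* C :* (a :* A)) refl
                                                                  a (fromℕ (n C suc j)) (c ^ suc j) (a ^ (n ∸ suc j)) ⟩
      fromℕ (n C suc j) ⊗ c ^ suc j ⊗ a ^ suc (n ∸ suc j)    ≡⟨ cong (λ m → fromℕ (n C suc j) ⊗ c ^ suc j ⊗ a ^ m) (∸-suc j<n) ⟨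
      U j                                                      ∎))

  evenPart oddPart : ℕ → QExt → QExt → QExt
  evenPart k a c = ∑ (suc k) (λ i → binomialTerm (2 ℕ.* k) a c (2 ℕ.* i))
  oddPart  k a c = ∑ k (λ i → binomialTerm (2 ℕ.* k) a c (suc (2 ℕ.* i)))

  evenPart+oddPart : ∀ k a c → evenPart k a c ⊕ oddPart k a c ≡ (a ⊕ c) ^ (2 ℕ.* k)
  evenPart+oddPart k a c = trans (sym (∑-even-odd k (binomialTerm (2 ℕ.* k) a c))) (sym (binomial-theorem (2 ℕ.* k) a c))

  evenPart-oddPart : ∀ k a c → evenPart k a c ⊟ oddPart k a c ≡ (a ⊟ c) ^ (2 ℕ.* k)
  evenPart-oddPart k a c = begin
    evenPart k a c ⊟ oddPart k a c              ≡⟨ cong₂ _⊕_ even-⊝ odd-⊝ ⟨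
    evenPart k a (⊝ c) ⊕ oddPart k a (⊝ c)      ≡⟨ evenPart+oddPart k a (⊝ c) ⟩
    (a ⊟ c) ^ (2 ℕ.* k)                         ∎
    where
    open ≡-Reasoning
    open Solver
    n = 2 ℕ.* k
    even-⊝ : evenPart k a (⊝ c) ≡ evenPart k a c
    even-⊝ = ∑-cong (suc k) (λ i _ → cong (λ x → fromℕ (n C (2 ℕ.* i)) ⊗ x ⊗ a ^ (n ∸ 2 ℕ.* i)) (⊝x^2n≡x^2n c i))
    odd-⊝ : oddPart k a (⊝ c) ≡ ⊝ oddPart k a c
    odd-⊝ = begin
      oddPart k a (⊝ c)                                   ≡⟨ ∑-cong k (λ i _ → begin
          fromℕ (n C suc (2 ℕ.* i)) ⊗ (⊝ c ⊗ (⊝ c) ^ (2 ℕ.* i)) ⊗ a ^ (n ∸ suc (2 ℕ.* i))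
            ≡⟨ cong (λ x → fromℕ (n C suc (2 ℕ.* i)) ⊗ (⊝ c ⊗ x) ⊗ a ^ (n ∸ suc (2 ℕ.* i))) (⊝x^2n≡x^2n c i) ⟩
          fromℕ (n C suc (2 ℕ.* i)) ⊗ (⊝ c ⊗ c ^ (2 ℕ.* i)) ⊗ a ^ (n ∸ suc (2 ℕ.* i))
            ≡⟨ solve 4 (λ X c C A → X :* (:- c :* C) :* A := :- con 1ℚ :* (X :* (c :* C) :* A)) refl
                 (fromℕ (n C suc (2 ℕ.* i))) c (c ^ (2 ℕ.* i)) (a ^ (n ∸ suc (2 ℕ.* i))) ⟩
          ⊝ 1ᵉ ⊗ binomialTerm n a c (suc (2 ℕ.* i))          ∎) ⟩
      ∑ k (λ i → ⊝ 1ᵉ ⊗ binomialTerm n a c (suc (2 ℕ.* i))) ≡⟨ *-distribˡ-∑ k (⊝ 1ᵉ) _ ⟨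
      ⊝ 1ᵉ ⊗ oddPart k a c                                ≡⟨ solve 1 (λ O → :- con 1ℚ :* O := :- O) refl (oddPart k a c) ⟩
      ⊝ oddPart k a c                                     ∎

  2ᵉ : QExt
  2ᵉ = fromℕ 2

  √d⊗√d≡d : √d ⊗ √d ≡ ι d
  √d⊗√d≡d = cong₂ _,_ (solve 1 (λ d → con 0ℚ :* con 0ℚ :+ d :* (con 1ℚ :* con 1ℚ) := d) refl d) refl
    where open ℚ-Solver

  ι-⊗-imaginary : ∀ r q → ι r ⊗ (0ℚ , q) ≡ (0ℚ , r * q)
  ι-⊗-imaginary r q = cong₂ _,_ (solve 3 (λ d r q → r :* con 0ℚ :+ d :* (con 0ℚ :* q) := con 0ℚ) refl d r q)
                                (solve 2 (λ r q → r :* q :+ con 0ℚ :* con 0ℚ := r :* q) refl r q)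
    where open ℚ-Solver

  ∑-imaginary : ∀ n (g : ℕ → ℚ) → ∑ n (λ i → (0ℚ , g i)) ≡ (0ℚ , ∑ℚ n g)
  ∑-imaginary zero    g = refl
  ∑-imaginary (suc n) g = cong ((0ℚ , g 0) ⊕_) (∑-imaginary n (g ∘ suc))

  ^⊟^-recurrence : ∀ u v m → u ^ suc (suc m) ⊟ v ^ suc (suc m) ≡ (u ⊕ v) ⊗ (u ^ suc m ⊟ v ^ suc m) ⊟ u ⊗ v ⊗ (u ^ m ⊟ v ^ m)
  ^⊟^-recurrence u v m = solve 4 (λ u v U V → u :* (u :* U) :- v :* (v :* V) := (u :+ v) :* (u :* U :- v :* V) :- u :* v :* (U :- V))
                           refl u v (u ^ m) (v ^ m)
    where open Solver

  Γ : QExt → QExt → ℕ → QExt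
  Γ a b n = a ⊗ (1ᵉ ⊕ b) ^ n ⊕ b ⊗ (1ᵉ ⊕ a) ^ n ⊕ a ⊗ a ^ n ⊕ b ⊗ b ^ n

  Γ-comm : ∀ a b n → Γ a b n ≡ Γ b a n
  Γ-comm a b n = solve 6 (λ a b u v w z → a :* u :+ b :* v :+ a :* w :+ b :* z := b :* v :+ a :* u :+ b :* z :+ a :* w) refl
                   a b ((1ᵉ ⊕ b) ^ n) ((1ᵉ ⊕ a) ^ n) (a ^ n) (b ^ n)
    where open Solver

  module CoefficientSum (x : ℚ) (a : QExt) (k : ℕ) where

    n : ℕ
    n = 2 ℕ.* k

    W : ℕ → QExt
    W i = a ^ (n ∸ 2 ℕ.* i)

    coefSum : QExt
    coefSum = ∑ (suc k) (λ i → ι (coef k i x) ⊗ W i)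

    termA termB termC termE : ℕ → QExt
    termA i = fromℕ (n C (2 ℕ.* i)) ⊗ (2ᵉ ^ (2 ℕ.* i ∸ 1) ⊟ 1ᵉ) ⊗ W i
    termB i = fromℕ (n C (2 ℕ.* i ℕ.+ 2)) ⊗ (2ᵉ ^ (2 ℕ.* i ℕ.+ 1) ⊟ 1ᵉ) ⊗ W i
    termC i = 2ᵉ ^ (2 ℕ.* i) ⊗ fromℕ (n C (2 ℕ.* i ℕ.+ 1)) ⊗ W i
    termE i = fromℕ (n C (2 ℕ.* i)) ⊗ W i

    ι-coef-⊗-W : ∀ i → ι (coef k i x) ⊗ W i ≡ ι (ℕ→ℚ 6 * x) ⊗ termA i ⊕ termB i ⊟ termC i ⊕ termE i
    ι-coef-⊗-W i = begin
      ι (coef k i x) ⊗ W i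
        ≡⟨ cong (_⊗ W i) (cong₂ (λ u v → u ⊟ v ⊕ X₀) (cong₂ _⊕_ ι-first ι-second) ι-third) ⟩
      (p ⊗ X₀ ⊗ (Y₀ ⊟ 1ᵉ) ⊕ X₂ ⊗ (Y₁ ⊟ 1ᵉ) ⊟ Y₂ ⊗ X₁ ⊕ X₀) ⊗ W i
        ≡⟨ solve 8 (λ p X₀ X₁ X₂ Y₀ Y₁ Y₂ w →
               (p :* X₀ :* (Y₀ :- con 1ℚ) :+ X₂ :* (Y₁ :- con 1ℚ) :- Y₂ :* X₁ :+ X₀) :* w
            := p :* (X₀ :* (Y₀ :- con 1ℚ) :* w) :+ X₂ :* (Y₁ :- con 1ℚ) :* w :- Y₂ :* X₁ :* w :+ X₀ :* w)
             refl p X₀ X₁ X₂ Y₀ Y₁ Y₂ (W i) ⟩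
      p ⊗ termA i ⊕ termB i ⊟ termC i ⊕ termE i
        ∎
      where
      open ≡-Reasoning
      open Solver
      p  = ι (ℕ→ℚ 6 * x)
      X₀ = fromℕ (n C (2 ℕ.* i))
      X₁ = fromℕ (n C (2 ℕ.* i ℕ.+ 1))
      X₂ = fromℕ (n C (2 ℕ.* i ℕ.+ 2))
      Y₀ = 2ᵉ ^ (2 ℕ.* i ∸ 1)
      Y₁ = 2ᵉ ^ (2 ℕ.* i ℕ.+ 1)
      Y₂ = 2ᵉ ^ (2 ℕ.* i)
      ι-first : ι (ℕ→ℚ 6 * x * ℕ→ℚ (n C (2 ℕ.* i)) * (ℕ→ℚ 2 ^ℚ (2 ℕ.* i ∸ 1) - 1ℚ)) ≡ p ⊗ X₀ ⊗ (Y₀ ⊟ 1ᵉ)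
      ι-first = trans (ι-* (ℕ→ℚ 6 * x * ℕ→ℚ (n C (2 ℕ.* i))) _)
                      (cong₂ _⊗_ (ι-* (ℕ→ℚ 6 * x) _) (cong (_⊟ 1ᵉ) (ι-^ (ℕ→ℚ 2) (2 ℕ.* i ∸ 1))))
      ι-second : ι (ℕ→ℚ (n C (2 ℕ.* i ℕ.+ 2)) * (ℕ→ℚ 2 ^ℚ (2 ℕ.* i ℕ.+ 1) - 1ℚ)) ≡ X₂ ⊗ (Y₁ ⊟ 1ᵉ)
      ι-second = trans (ι-* (ℕ→ℚ (n C (2 ℕ.* i ℕ.+ 2))) _) (cong (λ u → X₂ ⊗ (u ⊟ 1ᵉ)) (ι-^ (ℕ→ℚ 2) (2 ℕ.* i ℕ.+ 1)))
      ι-third : ι (ℕ→ℚ 2 ^ℚ (2 ℕ.* i) * ℕ→ℚ (n C (2 ℕ.* i ℕ.+ 1))) ≡ Y₂ ⊗ X₁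
      ι-third = trans (ι-* (ℕ→ℚ 2 ^ℚ (2 ℕ.* i)) _) (cong (_⊗ X₁) (ι-^ (ℕ→ℚ 2) (2 ℕ.* i)))

    coefSum-split : coefSum ≡ ι (ℕ→ℚ 6 * x) ⊗ ∑ (suc k) termA ⊕ ∑ (suc k) termB ⊟ ∑ (suc k) termC ⊕ ∑ (suc k) termE
    coefSum-split = begin
      coefSum                                                  ≡⟨ ∑-cong (suc k) (λ i _ → ι-coef-⊗-W i) ⟩
      ∑ (suc k) (λ i → p ⊗ termA i ⊕ termB i ⊟ termC i ⊕ termE i) ≡⟨ ∑-+ (suc k) (λ i → p ⊗ termA i ⊕ termB i ⊟ termC i) termE ⟩
      ∑ (suc k) (λ i → p ⊗ termA i ⊕ termB i ⊟ termC i) ⊕ ∑E      ≡⟨ cong (_⊕ ∑E) (∑-- (suc k) (λ i → p ⊗ termA i ⊕ termB i) termC) ⟩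
      ∑ (suc k) (λ i → p ⊗ termA i ⊕ termB i) ⊟ ∑C ⊕ ∑E          ≡⟨ cong (λ u → u ⊟ ∑C ⊕ ∑E) (∑-+ (suc k) (λ i → p ⊗ termA i) termB) ⟩
      ∑ (suc k) (λ i → p ⊗ termA i) ⊕ ∑B ⊟ ∑C ⊕ ∑E              ≡⟨ cong (λ u → u ⊕ ∑B ⊟ ∑C ⊕ ∑E) (*-distribˡ-∑ (suc k) p termA) ⟨
      p ⊗ ∑ (suc k) termA ⊕ ∑B ⊟ ∑C ⊕ ∑E                        ∎
      where
      open ≡-Reasoning
      p = ι (ℕ→ℚ 6 * x)
      ∑B = ∑ (suc k) termB
      ∑C = ∑ (suc k) termC
      ∑E = ∑ (suc k) termE

    K : QExt
    K = 2ᵉ ⊗ ∑ k (termA ∘ suc)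

    -- The i = 0 term vanishes because 2 ^ (0 ∸ 1) = 1 with truncated subtraction.
    ∑termA : ∑ (suc k) termA ≡ ∑ k (termA ∘ suc)
    ∑termA = solve 2 (λ w A → con 1ℚ :* (con 1ℚ :- con 1ℚ) :* w :+ A := A) refl (W 0) (∑ k (termA ∘ suc))
      where open Solver

    K≡ : K ≡ evenPart k a 2ᵉ ⊟ 2ᵉ ⊗ evenPart k a 1ᵉ ⊕ a ^ n
    K≡ = begin
      2ᵉ ⊗ ∑ k (termA ∘ suc)                       ≡⟨ *-distribˡ-∑ k 2ᵉ (termA ∘ suc) ⟩
      ∑ k (λ i → 2ᵉ ⊗ termA (suc i))               ≡⟨ ∑-cong k (λ i _ → 2termA i) ⟩
      ∑ k (λ i → E₂ i ⊟ 2ᵉ ⊗ E₁ i)                 ≡⟨ ∑-- k E₂ (λ i → 2ᵉ ⊗ E₁ i) ⟩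
      ∑ k E₂ ⊟ ∑ k (λ i → 2ᵉ ⊗ E₁ i)               ≡⟨ cong (∑ k E₂ ⊟_) (*-distribˡ-∑ k 2ᵉ E₁) ⟨
      ∑ k E₂ ⊟ 2ᵉ ⊗ ∑ k E₁                         ≡⟨ solve 3 (λ A X Y → X :- con (ℕ→ℚ 2) :* Y
                                                          := con 1ℚ :* con 1ℚ :* A :+ X :- con (ℕ→ℚ 2) :* (con 1ℚ :* con 1ℚ :* A :+ Y) :+ A)
                                                          refl (a ^ n) (∑ k E₂) (∑ k E₁) ⟩
      evenPart k a 2ᵉ ⊟ 2ᵉ ⊗ evenPart k a 1ᵉ ⊕ a ^ n ∎
      where
      open ≡-Reasoning
      open Solver
      E₁ E₂ : ℕ → QExt
      E₁ i = binomialTerm n a 1ᵉ (2 ℕ.* suc i)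
      E₂ i = binomialTerm n a 2ᵉ (2 ℕ.* suc i)
      2termA : ∀ i → 2ᵉ ⊗ termA (suc i) ≡ E₂ i ⊟ 2ᵉ ⊗ E₁ i
      2termA i = begin
        2ᵉ ⊗ (X ⊗ (Y ⊟ 1ᵉ) ⊗ w)              ≡⟨ solve 3 (λ X Y w → con (ℕ→ℚ 2) :* (X :* (Y :- con 1ℚ) :* w)
                                                  := X :* (con (ℕ→ℚ 2) :* Y) :* w :- con (ℕ→ℚ 2) :* (X :* con 1ℚ :* w)) refl X Y w ⟩
        E₂ i ⊟ 2ᵉ ⊗ (X ⊗ 1ᵉ ⊗ w)             ≡⟨ cong (λ u → E₂ i ⊟ 2ᵉ ⊗ (X ⊗ u ⊗ w)) (1^n≡1 (2 ℕ.* suc i)) ⟨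
        E₂ i ⊟ 2ᵉ ⊗ E₁ i                     ∎
        where
        X = fromℕ (n C (2 ℕ.* suc i))
        Y = 2ᵉ ^ (2 ℕ.* suc i ∸ 1)
        w = W (suc i)

    ∑termB : ∑ (suc k) termB ≡ a ⊗ a ⊗ ∑ k (termA ∘ suc)
    ∑termB = begin
      ∑ (suc k) termB                       ≡⟨ ∑-last-zero k termB termB-last ⟩
      ∑ k termB                             ≡⟨ ∑-cong k termB≡a²termA ⟩
      ∑ k (λ i → a ⊗ a ⊗ termA (suc i))     ≡⟨ *-distribˡ-∑ k (a ⊗ a) (termA ∘ suc) ⟨
      a ⊗ a ⊗ ∑ k (termA ∘ suc)             ∎
      where
      open ≡-Reasoning
      open Solver
      termB-last : termB k ≡ 0ᵉ
      termB-last = begin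
        fromℕ (n C (n ℕ.+ 2)) ⊗ Y ⊗ W k   ≡⟨ cong (λ m → fromℕ m ⊗ Y ⊗ W k) (k>n⇒nCk≡0 (ℕₚ.m<m+n n (s≤s z≤n))) ⟩
        fromℕ 0 ⊗ Y ⊗ W k                  ≡⟨ solve 2 (λ Y w → con 0ℚ :* Y :* w := con 0ℚ) refl Y (W k) ⟩
        0ᵉ                                  ∎
        where Y = 2ᵉ ^ (n ℕ.+ 1) ⊟ 1ᵉ
      termB≡a²termA : ∀ i → i < k → termB i ≡ a ⊗ a ⊗ termA (suc i)
      termB≡a²termA i i<k = begin
        fromℕ (n C (2 ℕ.* i ℕ.+ 2)) ⊗ (2ᵉ ^ (2 ℕ.* i ℕ.+ 1) ⊟ 1ᵉ) ⊗ a ^ (n ∸ 2 ℕ.* i)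
          ≡⟨ cong₃ (λ m m′ m″ → fromℕ (n C m) ⊗ (2ᵉ ^ m′ ⊟ 1ᵉ) ⊗ a ^ m″)
               (trans (ℕₚ.+-comm (2 ℕ.* i) 2) (sym (2*suc i)))
               (trans (ℕₚ.+-comm (2 ℕ.* i) 1) (cong (_∸ 1) (sym (2*suc i))))
               (2k∸2i≡2+[2k∸2[1+i]] i<k) ⟩
        X ⊗ (Y ⊟ 1ᵉ) ⊗ (a ⊗ (a ⊗ w))
          ≡⟨ solve 4 (λ a X Y w → X :* (Y :- con 1ℚ) :* (a :* (a :* w)) := a :* a :* (X :* (Y :- con 1ℚ) :* w)) refl a X Y w ⟩
        a ⊗ a ⊗ termA (suc i)
          ∎
        where
        X = fromℕ (n C (2 ℕ.* suc i))
        Y = 2ᵉ ^ (2 ℕ.* suc i ∸ 1)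
        w = W (suc i)

    2∑termC : 2ᵉ ⊗ ∑ (suc k) termC ≡ a ⊗ oddPart k a 2ᵉ
    2∑termC = begin
      2ᵉ ⊗ ∑ (suc k) termC                                ≡⟨ cong (2ᵉ ⊗_) (∑-last-zero k termC termC-last) ⟩
      2ᵉ ⊗ ∑ k termC                                      ≡⟨ *-distribˡ-∑ k 2ᵉ termC ⟩
      ∑ k (λ i → 2ᵉ ⊗ termC i)                            ≡⟨ ∑-cong k 2termC ⟩
      ∑ k (λ i → a ⊗ binomialTerm n a 2ᵉ (suc (2 ℕ.* i))) ≡⟨ *-distribˡ-∑ k a _ ⟨
      a ⊗ oddPart k a 2ᵉ                                  ∎
      where
      open ≡-Reasoning
      open Solver
      termC-last : termC k ≡ 0ᵉ
      termC-last = begin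
        2ᵉ ^ n ⊗ fromℕ (n C (n ℕ.+ 1)) ⊗ W k   ≡⟨ cong (λ m → 2ᵉ ^ n ⊗ fromℕ m ⊗ W k) (k>n⇒nCk≡0 (ℕₚ.m<m+n n (s≤s z≤n))) ⟩
        2ᵉ ^ n ⊗ fromℕ 0 ⊗ W k                  ≡⟨ solve 2 (λ Y w → Y :* con 0ℚ :* w := con 0ℚ) refl (2ᵉ ^ n) (W k) ⟩
        0ᵉ                                       ∎
      2termC : ∀ i → i < k → 2ᵉ ⊗ termC i ≡ a ⊗ binomialTerm n a 2ᵉ (suc (2 ℕ.* i))
      2termC i i<k = begin
        2ᵉ ⊗ (Y ⊗ fromℕ (n C (2 ℕ.* i ℕ.+ 1)) ⊗ a ^ (n ∸ 2 ℕ.* i))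
          ≡⟨ cong₂ (λ m m′ → 2ᵉ ⊗ (Y ⊗ fromℕ (n C m) ⊗ a ^ m′)) (ℕₚ.+-comm (2 ℕ.* i) 1) (∸-suc (ℕₚ.*-monoʳ-< 2 i<k)) ⟩
        2ᵉ ⊗ (Y ⊗ X ⊗ (a ⊗ w))
          ≡⟨ solve 5 (λ c a X Y w → c :* (Y :* X :* (a :* w)) := a :* (X :* (c :* Y) :* w)) refl 2ᵉ a X Y w ⟩
        a ⊗ binomialTerm n a 2ᵉ (suc (2 ℕ.* i))
          ∎
        where
        X = fromℕ (n C suc (2 ℕ.* i))
        Y = 2ᵉ ^ (2 ℕ.* i)
        w = a ^ (n ∸ suc (2 ℕ.* i))

    ∑termE : ∑ (suc k) termE ≡ evenPart k a 1ᵉ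
    ∑termE = ∑-cong (suc k) (λ i _ → begin
      fromℕ (n C (2 ℕ.* i)) ⊗ W i          ≡⟨ solve 2 (λ X w → X :* w := X :* con 1ℚ :* w) refl (fromℕ (n C (2 ℕ.* i))) (W i) ⟩
      fromℕ (n C (2 ℕ.* i)) ⊗ 1ᵉ ⊗ W i     ≡⟨ cong (λ u → fromℕ (n C (2 ℕ.* i)) ⊗ u ⊗ W i) (1^n≡1 (2 ℕ.* i)) ⟨
      binomialTerm n a 1ᵉ (2 ℕ.* i)         ∎)
      where
      open ≡-Reasoning
      open Solver

    2⊗coefSum≡Γ : ∀ b → a ⊕ b ≡ 1ᵉ → a ⊗ b ≡ ι (ℕ→ℚ 6 * x) → 2ᵉ ⊗ coefSum ≡ Γ a b n
    2⊗coefSum≡Γ b a+b≡1 ab≡6x = begin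
      2ᵉ ⊗ coefSum
        ≡⟨ cong (2ᵉ ⊗_) coefSum-split ⟩
      2ᵉ ⊗ (ι (ℕ→ℚ 6 * x) ⊗ ∑ (suc k) termA ⊕ ∑ (suc k) termB ⊟ ∑C ⊕ ∑ (suc k) termE)
        ≡⟨ cong₃ (λ u v w → 2ᵉ ⊗ (u ⊕ v ⊟ ∑C ⊕ w)) (cong₂ _⊗_ (sym ab≡6x) ∑termA) ∑termB ∑termE ⟩
      2ᵉ ⊗ (a ⊗ b ⊗ A ⊕ a ⊗ a ⊗ A ⊟ ∑C ⊕ E₁)
        ≡⟨ solve 5 (λ a b A C E → con (ℕ→ℚ 2) :* (a :* b :* A :+ a :* a :* A :- C :+ E)
                                  := a :* (a :+ b) :* (con (ℕ→ℚ 2) :* A) :- con (ℕ→ℚ 2) :* C :+ con (ℕ→ℚ 2) :* E) refl a b A ∑C E₁ ⟩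
      a ⊗ (a ⊕ b) ⊗ K ⊟ 2ᵉ ⊗ ∑C ⊕ 2ᵉ ⊗ E₁
        ≡⟨ cong₃ (λ u v w → a ⊗ u ⊗ v ⊟ w ⊕ 2ᵉ ⊗ E₁) a+b≡1 K≡ 2∑termC ⟩
      a ⊗ 1ᵉ ⊗ (E₂ ⊟ 2ᵉ ⊗ E₁ ⊕ a ^ n) ⊟ a ⊗ O₂ ⊕ 2ᵉ ⊗ E₁
        ≡⟨ solve 5 (λ a E₁ E₂ O₂ Aⁿ → a :* con 1ℚ :* (E₂ :- con (ℕ→ℚ 2) :* E₁ :+ Aⁿ) :- a :* O₂ :+ con (ℕ→ℚ 2) :* E₁
                                      := a :* (E₂ :- O₂) :+ a :* Aⁿ :+ (con 1ℚ :- a) :* (con (ℕ→ℚ 2) :* E₁)) refl a E₁ E₂ O₂ (a ^ n) ⟩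
      a ⊗ (E₂ ⊟ O₂) ⊕ a ⊗ a ^ n ⊕ (1ᵉ ⊟ a) ⊗ (2ᵉ ⊗ E₁)
        ≡⟨ cong₃ (λ u v w → a ⊗ u ⊕ a ⊗ a ^ n ⊕ v ⊗ w) E₂⊟O₂ 1⊟a≡b 2E₁ ⟩
      a ⊗ (1ᵉ ⊕ b) ^ n ⊕ a ⊗ a ^ n ⊕ b ⊗ ((1ᵉ ⊕ a) ^ n ⊕ b ^ n)
        ≡⟨ solve 6 (λ a b u v w z → a :* u :+ a :* w :+ b :* (v :+ z) := a :* u :+ b :* v :+ a :* w :+ b :* z) refl
             a b ((1ᵉ ⊕ b) ^ n) ((1ᵉ ⊕ a) ^ n) (a ^ n) (b ^ n) ⟩
      Γ a b n
        ∎
      where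
      open ≡-Reasoning
      open Solver
      A = ∑ k (termA ∘ suc)
      ∑C = ∑ (suc k) termC
      E₁ = evenPart k a 1ᵉ
      E₂ = evenPart k a 2ᵉ
      O₂ = oddPart k a 2ᵉ
      1⊟a≡b : 1ᵉ ⊟ a ≡ b
      1⊟a≡b = trans (cong (_⊟ a) (sym a+b≡1)) (solve 2 (λ a b → a :+ b :- a := b) refl a b)
      a⊟c≡⊝[c-1+b] : ∀ c → a ⊟ c ≡ ⊝ (c ⊟ 1ᵉ ⊕ b)
      a⊟c≡⊝[c-1+b] c = begin
        a ⊟ c             ≡⟨ solve 3 (λ a b c → a :- c := (a :+ b) :- c :- b) refl a b c ⟩
        (a ⊕ b) ⊟ c ⊟ b   ≡⟨ cong (λ u → u ⊟ c ⊟ b) a+b≡1 ⟩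
        1ᵉ ⊟ c ⊟ b        ≡⟨ solve 2 (λ b c → con 1ℚ :- c :- b := :- (c :- con 1ℚ :+ b)) refl b c ⟩
        ⊝ (c ⊟ 1ᵉ ⊕ b)    ∎
      E₂⊟O₂ : E₂ ⊟ O₂ ≡ (1ᵉ ⊕ b) ^ n
      E₂⊟O₂ = begin
        E₂ ⊟ O₂                   ≡⟨ evenPart-oddPart k a 2ᵉ ⟩
        (a ⊟ 2ᵉ) ^ n              ≡⟨ cong (_^ n) (a⊟c≡⊝[c-1+b] 2ᵉ) ⟩
        (⊝ (2ᵉ ⊟ 1ᵉ ⊕ b)) ^ n     ≡⟨ ⊝x^2n≡x^2n (2ᵉ ⊟ 1ᵉ ⊕ b) k ⟩
        (2ᵉ ⊟ 1ᵉ ⊕ b) ^ n         ≡⟨ cong (_^ n) (solve 1 (λ b → con (ℕ→ℚ 2) :- con 1ℚ :+ b := con 1ℚ :+ b) refl b) ⟩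
        (1ᵉ ⊕ b) ^ n              ∎
      2E₁ : 2ᵉ ⊗ E₁ ≡ (1ᵉ ⊕ a) ^ n ⊕ b ^ n
      2E₁ = begin
        2ᵉ ⊗ E₁                                   ≡⟨ solve 2 (λ E O → con (ℕ→ℚ 2) :* E := (E :+ O) :+ (E :- O)) refl E₁ O₁ ⟩
        (E₁ ⊕ O₁) ⊕ (E₁ ⊟ O₁)                     ≡⟨ cong₂ _⊕_ (evenPart+oddPart k a 1ᵉ) (evenPart-oddPart k a 1ᵉ) ⟩
        (a ⊕ 1ᵉ) ^ n ⊕ (a ⊟ 1ᵉ) ^ n               ≡⟨ cong₂ (λ u v → u ^ n ⊕ v ^ n) (solve 1 (λ a → a :+ con 1ℚ := con 1ℚ :+ a) refl a) (a⊟c≡⊝[c-1+b] 1ᵉ) ⟩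
        (1ᵉ ⊕ a) ^ n ⊕ (⊝ (1ᵉ ⊟ 1ᵉ ⊕ b)) ^ n      ≡⟨ cong ((1ᵉ ⊕ a) ^ n ⊕_) (⊝x^2n≡x^2n (1ᵉ ⊟ 1ᵉ ⊕ b) k) ⟩
        (1ᵉ ⊕ a) ^ n ⊕ (1ᵉ ⊟ 1ᵉ ⊕ b) ^ n          ≡⟨ cong (λ u → (1ᵉ ⊕ a) ^ n ⊕ u ^ n) (solve 1 (λ b → con 1ℚ :- con 1ℚ :+ b := b) refl b) ⟩
        (1ᵉ ⊕ a) ^ n ⊕ b ^ n                      ∎
        where O₁ = oddPart k a 1ᵉ

at-++-< : ∀ (qs : List ℚ) q {j} → j < length qs → at (qs ++ q ∷ []) j ≡ at qs j
at-++-< (_ ∷ qs) q {zero}  _         = refl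
at-++-< (_ ∷ qs) q {suc j} (s≤s j<n) = at-++-< qs q j<n

at-++-length : ∀ (qs : List ℚ) q → at (qs ++ q ∷ []) (length qs) ≡ q
at-++-length []       q = refl
at-++-length (_ ∷ qs) q = at-++-length qs q

at-++-extends : ∀ (qs : List ℚ) {q n} (f : ℕ → ℚ) → length qs ≡ suc n →
                (∀ j → j ≤ n → at qs j ≡ f j) → q ≡ f (suc n) → ∀ j → j ≤ suc n → at (qs ++ q ∷ []) j ≡ f j
at-++-extends qs {q} f |qs|≡1+n qs≡f q≡f j j≤1+n with ℕₚ.m≤n⇒m<n∨m≡n j≤1+n
... | inj₁ j<1+n = trans (at-++-< qs q (subst (j <_) (sym |qs|≡1+n) j<1+n)) (qs≡f j (ℕₚ.≤-pred j<1+n))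
... | inj₂ refl  = trans (cong (at (qs ++ q ∷ [])) (sym |qs|≡1+n)) (trans (at-++-length qs q) q≡f)

module Polynomials (x : ℚ) where

  d : ℚ
  d = 1ℚ - ℕ→ℚ 24 * x

  open QuadraticExtension d

  -- The Lucas sequence U(1 − 12x, 36x²); its characteristic roots are α² and β² below.
  U : ℕ → ℚ
  U 0             = 0ℚ
  U 1             = 1ℚ
  U (suc (suc m)) = (1ℚ - ℕ→ℚ 12 * x) * U (suc m) - ℕ→ℚ 36 * (x * x) * U m

  α β : QExt
  α = (½ , ½)
  β = (½ , - ½)

  α⊕β≡1 : α ⊕ β ≡ 1ᵉ
  α⊕β≡1 = refl

  α⊗β≡6x : α ⊗ β ≡ ι (ℕ→ℚ 6 * x)
  α⊗β≡6x = cong₂ _,_ (solve 1 (λ x → con ½ :* con ½ :+ (con 1ℚ :- con (ℕ→ℚ 24) :* x) :* (con ½ :* :- con ½) := con (ℕ→ℚ 6) :* x) refl x)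
                     (solve 0 (con ½ :* :- con ½ :+ con ½ :* con ½ := con 0ℚ) refl)
    where open ℚ-Solver

  2α≡1+√d : 2ᵉ ⊗ α ≡ 1ᵉ ⊕ √d
  2α≡1+√d = cong₂ _,_ (solve 1 (λ d → con (ℕ→ℚ 2) :* con ½ :+ d :* (con 0ℚ :* con ½) := con 1ℚ) refl d) refl
    where open ℚ-Solver

  2β≡1-√d : 2ᵉ ⊗ β ≡ 1ᵉ ⊟ √d
  2β≡1-√d = cong₂ _,_ (solve 1 (λ d → con (ℕ→ℚ 2) :* con ½ :+ d :* (con 0ℚ :* :- con ½) := con 1ℚ) refl d) refl
    where open ℚ-Solver

  α²⊕β² : α ⊗ α ⊕ β ⊗ β ≡ ι (1ℚ - ℕ→ℚ 12 * x)
  α²⊕β² = cong₂ _,_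
    (solve 1 (λ x → con ½ :* con ½ :+ (con 1ℚ :- con (ℕ→ℚ 24) :* x) :* (con ½ :* con ½)
                    :+ (con ½ :* con ½ :+ (con 1ℚ :- con (ℕ→ℚ 24) :* x) :* (:- con ½ :* :- con ½))
                    := con 1ℚ :- con (ℕ→ℚ 12) :* x) refl x)
    (solve 0 (con ½ :* con ½ :+ con ½ :* con ½ :+ (con ½ :* :- con ½ :+ :- con ½ :* con ½) := con 0ℚ) refl)
    where open ℚ-Solver

  α²⊗β² : α ⊗ α ⊗ (β ⊗ β) ≡ ι (ℕ→ℚ 36 * (x * x))
  α²⊗β² = begin
    α ⊗ α ⊗ (β ⊗ β)               ≡⟨ interchange α α β β ⟩
    α ⊗ β ⊗ (α ⊗ β)               ≡⟨ cong₂ _⊗_ α⊗β≡6x α⊗β≡6x ⟩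
    ι (ℕ→ℚ 6 * x) ⊗ ι (ℕ→ℚ 6 * x) ≡⟨ ι-* (ℕ→ℚ 6 * x) (ℕ→ℚ 6 * x) ⟨
    ι (ℕ→ℚ 6 * x * (ℕ→ℚ 6 * x))   ≡⟨ cong ι (solve 1 (λ x → con (ℕ→ℚ 6) :* x :* (con (ℕ→ℚ 6) :* x) := con (ℕ→ℚ 36) :* (x :* x)) refl x) ⟩
    ι (ℕ→ℚ 36 * (x * x))          ∎
    where
    open ≡-Reasoning
    open ℚ-Solver
    open import Algebra.Properties.CommutativeSemigroup (CommutativeRing.*-commutativeSemigroup commutativeRing) using (interchange)

  α²ᵐ⊟β²ᵐ : ∀ m → α ^ (2 ℕ.* m) ⊟ β ^ (2 ℕ.* m) ≡ (0ℚ , U m)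
  α²ᵐ⊟β²ᵐ m = trans (cong₂ _⊟_ (^-double α m) (^-double β m)) (squares m)
    where
    open ≡-Reasoning
    squares : ∀ m → (α ⊗ α) ^ m ⊟ (β ⊗ β) ^ m ≡ (0ℚ , U m)
    squares 0 = refl
    squares 1 = begin
      α ⊗ α ⊗ 1ᵉ ⊟ β ⊗ β ⊗ 1ᵉ   ≡⟨ solve 2 (λ a b → a :* a :* con 1ℚ :- b :* b :* con 1ℚ := (a :+ b) :* (a :- b)) refl α β ⟩
      (α ⊕ β) ⊗ (α ⊟ β)         ≡⟨ solve 1 (λ z → con 1ℚ :* z := z) refl (α ⊟ β) ⟩
      (0ℚ , 1ℚ)                 ∎
      where open Solver
    squares (suc (suc m)) = begin
      (α ⊗ α) ^ suc (suc m) ⊟ (β ⊗ β) ^ suc (suc m)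
        ≡⟨ ^⊟^-recurrence (α ⊗ α) (β ⊗ β) m ⟩
      (α ⊗ α ⊕ β ⊗ β) ⊗ ((α ⊗ α) ^ suc m ⊟ (β ⊗ β) ^ suc m) ⊟ α ⊗ α ⊗ (β ⊗ β) ⊗ ((α ⊗ α) ^ m ⊟ (β ⊗ β) ^ m)
        ≡⟨ cong₂ _⊟_ (cong₂ _⊗_ α²⊕β² (squares (suc m))) (cong₂ _⊗_ α²⊗β² (squares m)) ⟩
      ι (1ℚ - ℕ→ℚ 12 * x) ⊗ (0ℚ , U (suc m)) ⊟ ι (ℕ→ℚ 36 * (x * x)) ⊗ (0ℚ , U m)
        ≡⟨ cong₂ _⊟_ (ι-⊗-imaginary (1ℚ - ℕ→ℚ 12 * x) (U (suc m))) (ι-⊗-imaginary (ℕ→ℚ 36 * (x * x)) (U m)) ⟩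
      (0ℚ , U (suc (suc m)))
        ∎

  ∑coef-U≡0 : ∀ k → ∑ℚ (suc k) (λ i → coef k i x * U (k ∸ i)) ≡ 0ℚ
  ∑coef-U≡0 k = begin
    S                  ≡⟨ solve 1 (λ S → S := con ½ :* (con (ℕ→ℚ 2) :* S)) refl S ⟩
    ½ * (ℕ→ℚ 2 * S)    ≡⟨ cong (½ *_) (cong proj₂ 2S≡0) ⟩
    0ℚ                 ∎
    where
    open ≡-Reasoning
    open ℚ-Solver
    open CoefficientSum x using (coefSum; W)
    F : ℕ → ℚ
    F i = coef k i x * U (k ∸ i)
    S = ∑ℚ (suc k) F
    c : ℕ → QExt
    c i = ι (coef k i x)
    term : ∀ i → (0ℚ , F i) ≡ c i ⊗ W α k i ⊟ c i ⊗ W β k i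
    term i = begin
      (0ℚ , F i)                               ≡⟨ ι-⊗-imaginary (coef k i x) (U (k ∸ i)) ⟨
      c i ⊗ (0ℚ , U (k ∸ i))                   ≡⟨ cong (c i ⊗_) (α²ᵐ⊟β²ᵐ (k ∸ i)) ⟨
      c i ⊗ (α ^ (2 ℕ.* (k ∸ i)) ⊟ β ^ (2 ℕ.* (k ∸ i)))
                                               ≡⟨ cong (λ m → c i ⊗ (α ^ m ⊟ β ^ m)) (ℕₚ.*-distribˡ-∸ 2 k i) ⟩
      c i ⊗ (W α k i ⊟ W β k i)                ≡⟨ x[y-z]≈xy-xz (c i) (W α k i) (W β k i) ⟩
      c i ⊗ W α k i ⊟ c i ⊗ W β k i            ∎
    2S≡0 : (0ℚ , ℕ→ℚ 2 * S) ≡ 0ᵉ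
    2S≡0 = begin
      (0ℚ , ℕ→ℚ 2 * S)                               ≡⟨ ι-⊗-imaginary (ℕ→ℚ 2) S ⟨
      2ᵉ ⊗ (0ℚ , S)                                  ≡⟨ cong (2ᵉ ⊗_) (∑-imaginary (suc k) F) ⟨
      2ᵉ ⊗ ∑ (suc k) (λ i → (0ℚ , F i))              ≡⟨ cong (2ᵉ ⊗_) (trans (∑-cong (suc k) (λ i _ → term i)) (∑-- (suc k) (λ i → c i ⊗ W α k i) (λ i → c i ⊗ W β k i))) ⟩
      2ᵉ ⊗ (coefSum α k ⊟ coefSum β k)               ≡⟨ x[y-z]≈xy-xz 2ᵉ (coefSum α k) (coefSum β k) ⟩
      2ᵉ ⊗ coefSum α k ⊟ 2ᵉ ⊗ coefSum β k            ≡⟨ cong₂ _⊟_ (CoefficientSum.2⊗coefSum≡Γ x α k β α⊕β≡1 α⊗β≡6x)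
                                                                   (CoefficientSum.2⊗coefSum≡Γ x β k α refl (trans (*-comm β α) α⊗β≡6x)) ⟩
      Γ α β (2 ℕ.* k) ⊟ Γ β α (2 ℕ.* k)              ≡⟨ cong (Γ α β (2 ℕ.* k) ⊟_) (Γ-comm β α (2 ℕ.* k)) ⟩
      Γ α β (2 ℕ.* k) ⊟ Γ α β (2 ℕ.* k)              ≡⟨ -‿inverseʳ (Γ α β (2 ℕ.* k)) ⟩
      0ᵉ                                             ∎

  coef-zero : ∀ m → coef (suc (suc m)) 0 x ≡ ℕ→ℚ ((3 ℕ.+ 2 ℕ.* m) ℕ.* suc m)
  coef-zero m = begin
    coef k 0 x
      ≡⟨ cong (λ c → ℕ→ℚ 6 * x * 1ℚ * (1ℚ - 1ℚ) + C₂ * (ℕ→ℚ 2 * 1ℚ - 1ℚ) - 1ℚ * ℕ→ℚ c + 1ℚ) (nC1≡n n) ⟩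
    ℕ→ℚ 6 * x * 1ℚ * (1ℚ - 1ℚ) + C₂ * (ℕ→ℚ 2 * 1ℚ - 1ℚ) - 1ℚ * ℕ→ℚ n + 1ℚ
      ≡⟨ solve 3 (λ x C₂ n → con (ℕ→ℚ 6) :* x :* con 1ℚ :* (con 1ℚ :- con 1ℚ) :+ C₂ :* (con (ℕ→ℚ 2) :* con 1ℚ :- con 1ℚ) :- con 1ℚ :* n :+ con 1ℚ
                             := (C₂ :+ con 1ℚ) :- n) refl x C₂ (ℕ→ℚ n) ⟩
    (C₂ + 1ℚ) - ℕ→ℚ n
      ≡⟨ cong (_- ℕ→ℚ n) (trans (sym (ℕ→ℚ-+ (n C 2) 1)) (trans (cong ℕ→ℚ ([2k]C2+1 m)) (ℕ→ℚ-+ N n))) ⟩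
    (ℕ→ℚ N + ℕ→ℚ n) - ℕ→ℚ n
      ≡⟨ solve 2 (λ a b → (a :+ b) :- b := a) refl (ℕ→ℚ N) (ℕ→ℚ n) ⟩
    ℕ→ℚ N
      ∎
    where
    open ≡-Reasoning
    open ℚ-Solver
    k = suc (suc m)
    n = 2 ℕ.* k
    N = (3 ℕ.+ 2 ℕ.* m) ℕ.* suc m
    C₂ = ℕ→ℚ (n C 2)

  ∑coef-U-tail : ∀ m → ∑ℚ (suc m) (λ i → coef (suc (suc m)) (suc i) x * U (suc m ∸ i))
                       ≡ - (ℕ→ℚ ((3 ℕ.+ 2 ℕ.* m) ℕ.* suc m) * U (suc (suc m)))
  ∑coef-U-tail m = begin
    T                                        ≡⟨ solve 4 (λ a u T c → T := (a :* u :+ (T :+ c :* con 0ℚ)) :- a :* u) refl c₀ Uₖ T cₖ ⟩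
    (c₀ * Uₖ + (T + cₖ * 0ℚ)) - c₀ * Uₖ      ≡⟨ cong₂ (λ s c → s - c * Uₖ) whole≡0 (coef-zero m) ⟩
    0ℚ - ℕ→ℚ N * Uₖ                          ≡⟨ solve 1 (λ a → con 0ℚ :- a := :- a) refl (ℕ→ℚ N * Uₖ) ⟩
    - (ℕ→ℚ N * Uₖ)                           ∎
    where
    open ≡-Reasoning
    open ℚ-Solver
    k = suc (suc m)
    N = (3 ℕ.+ 2 ℕ.* m) ℕ.* suc m
    F : ℕ → ℚ
    F i = coef k i x * U (k ∸ i)
    T = ∑ℚ (suc m) (F ∘ suc)
    c₀ = coef k 0 x
    cₖ = coef k k x
    Uₖ = U k
    whole≡0 : c₀ * Uₖ + (T + cₖ * 0ℚ) ≡ 0ℚ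
    whole≡0 = begin
      c₀ * Uₖ + (T + cₖ * 0ℚ)          ≡⟨ cong (λ j → c₀ * Uₖ + (T + cₖ * U j)) (ℕₚ.n∸n≡0 m) ⟨
      c₀ * Uₖ + (T + F k)              ≡⟨ cong (_+_ (c₀ * Uₖ)) (∑ℚ-last (suc m) (F ∘ suc)) ⟨
      ∑ℚ (suc k) F                     ≡⟨ ∑coef-U≡0 k ⟩
      0ℚ                               ∎

  length-table : ∀ k → length (table x k) ≡ suc k
  length-table zero          = refl
  length-table (suc zero)    = refl
  length-table (suc (suc m)) = trans (length-++ (table x (suc m))) (trans (cong (ℕ._+ 1) (length-table (suc m))) (ℕₚ.+-comm (suc (suc m)) 1))

  table-next≡U : ∀ m → (∀ j → j ≤ suc m → at (table x (suc m)) j ≡ U j) →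
                 - (+ 1 / ((3 ℕ.+ 2 ℕ.* m) ℕ.* suc m))
                   * Σ[1≤i≤ suc m ] (λ i → coef (suc (suc m)) i x * at (table x (suc m)) (suc (suc m) ∸ i))
                 ≡ U (suc (suc m))
  table-next≡U m table≡U = begin
    - r * Σ[1≤i≤ suc m ] (λ i → coef k i x * at (table x (suc m)) (k ∸ i))
      ≡⟨ cong (- r *_) (trans (sumℚ-map-applyUpTo (suc m) (λ i → coef k (suc i) x * at (table x (suc m)) (k ∸ suc i)) (λ i → i))
                              (∑ℚ-cong (suc m) (λ i _ → cong (coef k (suc i) x *_) (table≡U (suc m ∸ i) (ℕₚ.m∸n≤m (suc m) i))))) ⟩
    - r * ∑ℚ (suc m) (λ i → coef k (suc i) x * U (suc m ∸ i))
      ≡⟨ cong (- r *_) (∑coef-U-tail m) ⟩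
    - r * - (ℕ→ℚ N * U k)
      ≡⟨ solve 3 (λ r n u → :- r :* :- (n :* u) := r :* n :* u) refl r (ℕ→ℚ N) (U k) ⟩
    r * ℕ→ℚ N * U k
      ≡⟨ cong (_* U k) (1/[1+n]*[1+n]≡1 (m ℕ.+ (2 ℕ.+ 2 ℕ.* m) ℕ.* suc m)) ⟩
    1ℚ * U k
      ≡⟨ ℚₚ.*-identityˡ (U k) ⟩
    U k
      ∎
    where
    open ≡-Reasoning
    open ℚ-Solver
    k = suc (suc m)
    N = (3 ℕ.+ 2 ℕ.* m) ℕ.* suc m
    r = + 1 / N

  table≡U : ∀ k j → j ≤ k → at (table x k) j ≡ U j
  table≡U zero          zero          _ = refl
  table≡U (suc zero)    zero          _ = refl
  table≡U (suc zero)    (suc zero)    _ = refl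
  table≡U (suc zero)    (suc (suc j)) (s≤s ())
  table≡U (suc (suc m)) = at-++-extends (table x (suc m)) U (length-table (suc m)) (table≡U (suc m)) (table-next≡U m (table≡U (suc m)))

  P≡U : ∀ k → P k x ≡ U k
  P≡U k = table≡U k k ℕₚ.≤-refl

  oddBinomialSum : ℕ → ℚ
  oddBinomialSum k = ∑ℚ k (λ j → ℕ→ℚ ((2 ℕ.* k) C (2 ℕ.* j ℕ.+ 1)) * d ^ℚ j)

  oddPart-1-√d : ∀ k → oddPart k 1ᵉ √d ≡ (0ℚ , oddBinomialSum k)
  oddPart-1-√d k = trans (∑-cong k (λ j _ → term j)) (∑-imaginary k (λ j → ℕ→ℚ (n C (2 ℕ.* j ℕ.+ 1)) * d ^ℚ j))
    where
    open ≡-Reasoning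
    open Solver
    n = 2 ℕ.* k
    √d^2j : ∀ j → √d ^ (2 ℕ.* j) ≡ ι (d ^ℚ j)
    √d^2j j = begin
      √d ^ (2 ℕ.* j)   ≡⟨ ^-double √d j ⟩
      (√d ⊗ √d) ^ j    ≡⟨ cong (_^ j) √d⊗√d≡d ⟩
      ι d ^ j          ≡⟨ ι-^ d j ⟨
      ι (d ^ℚ j)       ∎
    term : ∀ j → binomialTerm n 1ᵉ √d (suc (2 ℕ.* j)) ≡ (0ℚ , ℕ→ℚ (n C (2 ℕ.* j ℕ.+ 1)) * d ^ℚ j)
    term j = begin
      X ⊗ (√d ⊗ √d ^ (2 ℕ.* j)) ⊗ 1ᵉ ^ (n ∸ suc (2 ℕ.* j))  ≡⟨ cong₂ (λ u v → X ⊗ (√d ⊗ u) ⊗ v) (√d^2j j) (1^n≡1 (n ∸ suc (2 ℕ.* j))) ⟩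
      X ⊗ (√d ⊗ ι (d ^ℚ j)) ⊗ 1ᵉ                           ≡⟨ solve 3 (λ X s Y → X :* (s :* Y) :* con 1ℚ := X :* Y :* s) refl X √d (ι (d ^ℚ j)) ⟩
      X ⊗ ι (d ^ℚ j) ⊗ √d                                  ≡⟨ cong (_⊗ √d) (ι-* (ℕ→ℚ (n C suc (2 ℕ.* j))) (d ^ℚ j)) ⟨
      ι (ℕ→ℚ (n C suc (2 ℕ.* j)) * d ^ℚ j) ⊗ √d            ≡⟨ ι-⊗-imaginary (ℕ→ℚ (n C suc (2 ℕ.* j)) * d ^ℚ j) 1ℚ ⟩
      (0ℚ , ℕ→ℚ (n C suc (2 ℕ.* j)) * d ^ℚ j * 1ℚ)         ≡⟨ cong (0ℚ ,_) (ℚₚ.*-identityʳ (ℕ→ℚ (n C suc (2 ℕ.* j)) * d ^ℚ j)) ⟩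
      (0ℚ , ℕ→ℚ (n C suc (2 ℕ.* j)) * d ^ℚ j)              ≡⟨ cong (λ m → (0ℚ , ℕ→ℚ (n C m) * d ^ℚ j)) (ℕₚ.+-comm (2 ℕ.* j) 1) ⟨
      (0ℚ , ℕ→ℚ (n C (2 ℕ.* j ℕ.+ 1)) * d ^ℚ j)            ∎
      where X = fromℕ (n C suc (2 ℕ.* j))

  2^[2k]*U≡2*oddBinomialSum : ∀ k → ℕ→ℚ 2 ^ℚ (2 ℕ.* k) * U k ≡ ℕ→ℚ 2 * oddBinomialSum k
  2^[2k]*U≡2*oddBinomialSum k = cong proj₂ (begin
    (0ℚ , ℕ→ℚ 2 ^ℚ n * U k)                 ≡⟨ ι-⊗-imaginary (ℕ→ℚ 2 ^ℚ n) (U k) ⟨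
    ι (ℕ→ℚ 2 ^ℚ n) ⊗ (0ℚ , U k)             ≡⟨ cong₂ _⊗_ (ι-^ (ℕ→ℚ 2) n) (sym (α²ᵐ⊟β²ᵐ k)) ⟩
    2ᵉ ^ n ⊗ (α ^ n ⊟ β ^ n)                ≡⟨ x[y-z]≈xy-xz (2ᵉ ^ n) (α ^ n) (β ^ n) ⟩
    2ᵉ ^ n ⊗ α ^ n ⊟ 2ᵉ ^ n ⊗ β ^ n         ≡⟨ cong₂ _⊟_ (^-distrib-* 2ᵉ α n) (^-distrib-* 2ᵉ β n) ⟨
    (2ᵉ ⊗ α) ^ n ⊟ (2ᵉ ⊗ β) ^ n             ≡⟨ cong₂ (λ u v → u ^ n ⊟ v ^ n) 2α≡1+√d 2β≡1-√d ⟩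
    (1ᵉ ⊕ √d) ^ n ⊟ (1ᵉ ⊟ √d) ^ n           ≡⟨ cong₂ _⊟_ (evenPart+oddPart k 1ᵉ √d) (evenPart-oddPart k 1ᵉ √d) ⟨
    (E ⊕ O) ⊟ (E ⊟ O)                       ≡⟨ solve 2 (λ E O → (E :+ O) :- (E :- O) := con (ℕ→ℚ 2) :* O) refl E O ⟩
    2ᵉ ⊗ O                                  ≡⟨ cong (2ᵉ ⊗_) (oddPart-1-√d k) ⟩
    2ᵉ ⊗ (0ℚ , oddBinomialSum k)            ≡⟨ ι-⊗-imaginary (ℕ→ℚ 2) (oddBinomialSum k) ⟩
    (0ℚ , ℕ→ℚ 2 * oddBinomialSum k)         ∎)
    where
    open ≡-Reasoning
    open Solver
    n = 2 ℕ.* k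
    E = evenPart k 1ᵉ √d
    O = oddPart k 1ᵉ √d

  U≡½^[2k-1]*oddBinomialSum : ∀ k → 1 ≤ k → U k ≡ ½ ^ℚ (2 ℕ.* k ∸ 1) * oddBinomialSum k
  U≡½^[2k-1]*oddBinomialSum k@(suc _) _ = begin
    U k                                  ≡⟨ ℚₚ.*-identityˡ (U k) ⟨
    1ℚ * U k                             ≡⟨ cong (_* U k) (½^n*2^n≡1 r) ⟨
    ½ ^ℚ r * ℕ→ℚ 2 ^ℚ r * U k            ≡⟨ solve 3 (λ h t u → h :* t :* u := h :* (con ½ :* (con (ℕ→ℚ 2) :* t :* u))) refl (½ ^ℚ r) (ℕ→ℚ 2 ^ℚ r) (U k) ⟩
    ½ ^ℚ r * (½ * (ℕ→ℚ 2 ^ℚ (2 ℕ.* k) * U k)) ≡⟨ cong (λ u → ½ ^ℚ r * (½ * u)) (2^[2k]*U≡2*oddBinomialSum k) ⟩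
    ½ ^ℚ r * (½ * (ℕ→ℚ 2 * S))           ≡⟨ solve 2 (λ h S → h :* (con ½ :* (con (ℕ→ℚ 2) :* S)) := h :* S) refl (½ ^ℚ r) S ⟩
    ½ ^ℚ r * S                           ∎
    where
    open ≡-Reasoning
    open ℚ-Solver
    r = 2 ℕ.* k ∸ 1
    S = oddBinomialSum k

proposition7p1 : (x : ℚ) →
      ((k : ℕ) → 2 ≤ k →
        P k x ≡ (1ℚ - ℕ→ℚ 12 * x) * P (k ∸ 1) x - ℕ→ℚ 36 * (x * x) * P (k ∸ 2) x)
    × ((k : ℕ) → 1 ≤ k →
        P k x ≡ ½ ^ℚ (2 ℕ.* k ∸ 1)
                  * (Σ[0≤j< k ] (λ j → ℕ→ℚ ((2 ℕ.* k) C (2 ℕ.* j ℕ.+ 1)) * (1ℚ - ℕ→ℚ 24 * x) ^ℚ j)))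
    × ((k : ℕ) → 1 ≤ k →
        powQ (1ℚ - ℕ→ℚ 24 * x) (½ , ½) (2 ℕ.* k)
          ⊖[ 1ℚ - ℕ→ℚ 24 * x ] powQ (1ℚ - ℕ→ℚ 24 * x) (½ , - ½) (2 ℕ.* k)
        ≡ (0ℚ , P k x))
proposition7p1 x = recurrence , closed-form , binet
  where
  open Polynomials x
  open QuadraticExtension d using (powQ≡^; _⊟_)

  recurrence : ∀ k → 2 ≤ k → P k x ≡ (1ℚ - ℕ→ℚ 12 * x) * P (k ∸ 1) x - ℕ→ℚ 36 * (x * x) * P (k ∸ 2) x
  recurrence (suc zero)    (s≤s ())
  recurrence (suc (suc m)) _ = trans (P≡U (suc (suc m)))
    (cong₂ (λ u v → (1ℚ - ℕ→ℚ 12 * x) * u - ℕ→ℚ 36 * (x * x) * v) (sym (P≡U (suc m))) (sym (P≡U m)))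

  closed-form : ∀ k → 1 ≤ k → P k x ≡ ½ ^ℚ (2 ℕ.* k ∸ 1) * Σ[0≤j< k ] (λ j → ℕ→ℚ ((2 ℕ.* k) C (2 ℕ.* j ℕ.+ 1)) * d ^ℚ j)
  closed-form k 1≤k = trans (P≡U k) (trans (U≡½^[2k-1]*oddBinomialSum k 1≤k)
    (cong (½ ^ℚ (2 ℕ.* k ∸ 1) *_) (sym (sumℚ-map-applyUpTo k _ (λ j → j)))))

  binet : ∀ k → 1 ≤ k → powQ d (½ , ½) (2 ℕ.* k) ⊖[ d ] powQ d (½ , - ½) (2 ℕ.* k) ≡ (0ℚ , P k x)
  binet k _ = trans (cong₂ _⊟_ (powQ≡^ α (2 ℕ.* k)) (powQ≡^ β (2 ℕ.* k))) (trans (α²ᵐ⊟β²ᵐ k) (cong (0ℚ ,_) (sym (P≡U k))))
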